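{- Let $d\ge 0$ be an integer and let $G$ be a $d$-regular graph that contains no $4$-cycle. If $\mathrm{diam}(G)\geq 6$, then $\varphi(G)=d+1$.
   Context: All graphs are finite and simple (undirected, loopless, without multiple edges), with nonempty vertex set. "Contains no $4$-cycle" means that $G$ has no subgraph (not necessarily induced) isomorphic to the cycle $C_4$ of length $4$. The diameter $\mathrm{diam}(G)$ is the supremum of the distances between pairs of vertices of $G$, where two vertices in different connected components have distance $\infty$ (so a disconnected graph has infinite diameter). A b-coloring of a graph $G$ by $k$ colors is a proper vertex coloring with $k$ colors in which each of the $k$ color classes contains a vertex that is adjacent to at least one vertex in each of the other $k-1$ color classes. The b-chromatic number $\varphi(G)$ is the largest integer $k$ such that $G$ admits a b-coloring by $k$ colors. -}

module Defs where

open import Data.Fin.Base using (Fin; toℕ)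
open import Data.Fin.Patterns using (0F; 1F; 2F; 3F)
open import Data.Fin.Subset using (Subset; ∣_∣)
open import Data.Nat.Base using (ℕ; suc; _≤_; _%_)
open import Data.Nat.Properties using () renaming (_≟_ to _≟ℕ_)
open import Data.Product.Base using (∃; ∃-syntax; _×_)
open import Data.Vec.Base using (tabulate)
open import Function.Definitions using (Injective)
open import Level using (0ℓ)
open import Relation.Binary.Construct.Add.Supremum.NonStrict _≤_ public using () renaming (_≤⁺_ to _≤∞_)
open import Relation.Binary.Construct.Closure.Symmetric using (SymClosure; fwd; bwd; symmetric)
open import Relation.Binary.Core using (Rel)
open import Relation.Binary.Definitions using (Decidable; Symmetric)
open import Relation.Binary.PropositionalEquality using (_≡_; _≢_)
open import Relation.Nullary.Construct.Add.Supremum public using (_⁺; [_]; ⊤⁺)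
open import Relation.Nullary.Decidable using (yes; no; ⌊_⌋)
open import Relation.Nullary.Negation using (¬_)

-- Finite simple graphs, with vertices numbered 0, …, n - 1.
record Graph (n : ℕ) : Set₁ where
  field
    Adj     : Rel (Fin n) 0ℓ
    adj?    : Decidable Adj
    adj-sym : Symmetric Adj
    irrefl  : ∀ v → ¬ Adj v v

open Graph public

private
  variable
    m n : ℕ

neighbours : Graph n → Fin n → Subset n
neighbours G v = tabulate λ w → ⌊ adj? G v w ⌋

degree : Graph n → Fin n → ℕ
degree G v = ∣ neighbours G v ∣

Regular : ℕ → Graph n → Set
Regular d G = ∀ v → degree G v ≡ d

-- H is isomorphic to a (not necessarily induced) subgraph of G; such a
-- subgraph is the image of an injective homomorphism H → G.
Contains : Graph n → Graph m → Set
Contains {n} {m} G H =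
  ∃[ f ] (Injective {A = Fin m} {B = Fin n} _≡_ _≡_ f ×
          (∀ {i j} → Adj H i j → Adj G (f i) (f j)))

Next₄ : Rel (Fin 4) 0ℓ
Next₄ i j = toℕ j ≡ suc (toℕ i) % 4

adj₄? : Decidable (SymClosure Next₄)
adj₄? i j with toℕ j ≟ℕ suc (toℕ i) % 4 | toℕ i ≟ℕ suc (toℕ j) % 4
... | yes p | _     = yes (fwd p)
... | no  _ | yes q = yes (bwd q)
... | no ¬p | no ¬q = no λ { (fwd p) → ¬p p ; (bwd q) → ¬q q }

irrefl₄ : ∀ i → ¬ SymClosure Next₄ i i
irrefl₄ 0F (fwd ())
irrefl₄ 0F (bwd ())
irrefl₄ 1F (fwd ())
irrefl₄ 1F (bwd ())
irrefl₄ 2F (fwd ())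
irrefl₄ 2F (bwd ())
irrefl₄ 3F (fwd ())
irrefl₄ 3F (bwd ())

C₄ : Graph 4
C₄ = record
  { Adj     = SymClosure Next₄
  ; adj?    = adj₄?
  ; adj-sym = symmetric Next₄
  ; irrefl  = irrefl₄
  }

data Walk (G : Graph n) : ℕ → Fin n → Fin n → Set where
  nil  : ∀ {u} → Walk G 0 u u
  cons : ∀ {k u v w} → Adj G u v → Walk G k v w → Walk G (suc k) u w

-- ⊤⁺ is the value ∞.
ℕ∞ : Set
ℕ∞ = ℕ ⁺

-- IsDistance G u v e says that the distance from u to v is e.
data IsDistance (G : Graph n) (u v : Fin n) : ℕ∞ → Set where
  finite   : ∀ {k} → Walk G k u v → (∀ {l} → Walk G l u v → k ≤ l) →
             IsDistance G u v [ k ]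
  infinite : (∀ {l} → ¬ Walk G l u v) → IsDistance G u v ⊤⁺

BoundsDistances : Graph n → ℕ∞ → Set
BoundsDistances G B = ∀ u v e → IsDistance G u v e → e ≤∞ B

-- The supremum of the distances, as a relation.
IsDiameter : Graph n → ℕ∞ → Set
IsDiameter G D = BoundsDistances G D × (∀ B → BoundsDistances G B → D ≤∞ B)

ProperColouring : Graph n → (k : ℕ) → (Fin n → Fin k) → Set
ProperColouring G k c = ∀ {u v} → Adj G u v → c u ≢ c v

IsBColouring : Graph n → (k : ℕ) → (Fin n → Fin k) → Set
IsBColouring G k c =
  ProperColouring G k c ×
  (∀ i → ∃[ v ] (c v ≡ i × (∀ j → j ≢ i → ∃[ w ] (Adj G v w × c w ≡ j))))

HasBColouring : Graph n → ℕ → Set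
HasBColouring G k = ∃ (IsBColouring G k)

IsBChromaticNumber : Graph n → ℕ → Set
IsBChromaticNumber G k =
  HasBColouring G k × (∀ l → HasBColouring G l → l ≤ k)

{-# OPTIONS --safe #-}

-- Choose x and y at distance at least 6 and put k = ⌊d/2⌋. Colour the closed
-- neighbourhood of x with all d + 1 colours, then turn k neighbours of x, one
-- after the other, into b-vertices: colour the closed neighbourhood of such a
-- neighbour v by any bijection agreeing with the colours already in use, and
-- remove the conflicts at its vertices by transpositions. As there is no
-- 4-cycle, after r neighbours at most 3 vertices around v are precoloured, and
-- each of the r earlier neighbours rules out at most two exchange partners
-- for a given vertex, so a partner remains as long as 2 (r + 1) ≤ d.
-- The vertices coloured so far lie within distance 2 of x, hence doing the
-- same around y creates no conflict. Since 2 (k + 1) ≥ d + 1, the two families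
-- of b-vertices can be made to cover all colours, and a partial proper
-- colouring with d + 1 colours extends greedily.
module Submission where

open import Defs
open import Data.Fin.Base using (Fin; zero; suc; toℕ; fromℕ<; inject≤; opposite; punchOut; join; splitAt)
open import Data.Fin.Patterns using (0F; 1F; 2F; 3F)
open import Data.Fin.Permutation using (Permutation′; _⟨$⟩ʳ_; _⟨$⟩ˡ_; _∘ₚ_; transpose; inverseʳ; inverseˡ) renaming (id to idₚ)
open import Data.Fin.Properties using (_≟_; any?; all?; ¬∀⟶∃¬; injective⇒≤; punchOut-injective; suc-injective; splitAt-join; toℕ-injective; toℕ-fromℕ<; toℕ-inject≤; inject≤-injective; opposite-prop; opposite-involutive; toℕ<n)
open import Data.Fin.Subset using (Subset; ∣_∣)
open import Data.Nat.Base using (ℕ; zero; suc; NonZero; _+_; _≤_; z≤n; s≤s; s≤s⁻¹; ⌊_/2⌋; ⌈_/2⌉)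
open import Data.Nat.Properties using (≤-refl; ≤-trans; ≤-reflexive; ≤⇒≯; 1+n≰n; n≤1+n; ≮⇒≥; <⇒≱; ≰⇒>; _≤?_; +-suc; +-comm; +-mono-≤; +-monoʳ-≤; m≤n+o⇒m∸n≤o; ⌊n/2⌋+⌈n/2⌉≡n; ⌊n/2⌋≤⌈n/2⌉; ⌊n/2⌋≤n)
open import Data.Product.Base using (∃; ∃₂; _×_; _,_; proj₁; proj₂)
open import Data.Sum.Base using (_⊎_; inj₁; inj₂; [_,_]′)
open import Data.Vec.Base using ([]; _∷_; lookup)
open import Data.Vec.Functional using (updateAt)
open import Data.Vec.Functional.Properties using (updateAt-updates; updateAt-minimal)
open import Data.Vec.Properties using (lookup∘tabulate)
open import Data.Bool.Base using (true; false)
open import Data.Empty using (⊥-elim)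
open import Function.Base using (_∘_; const; id)
open import Function.Definitions using (Injective)
open import Level using (Level)
open import Relation.Binary.Construct.Closure.Symmetric using (SymClosure; fwd; bwd)
open import Relation.Binary.Construct.Add.Supremum.NonStrict _≤_ using ([_])
open import Relation.Binary.PropositionalEquality using (_≡_; _≢_; refl; sym; trans; cong; subst)
open import Relation.Nullary.Decidable using (Dec; yes; no; ⌊_⌋; _×-dec_; _⊎-dec_; ¬?; map′; isYes≗does; dec-true; dec-false)
open import Relation.Nullary.Negation using (¬_; contradiction)
open import Relation.Unary using (Pred; Decidable)

private
  variable
    ℓ : Level
    m n r s : ℕ

-- Counting principles on finite sets.

relational-pigeonhole : (C : Fin m → Fin n → Set) → (∀ i → ∃ (C i)) →
                        (∀ {i j a} → C i a → C j a → i ≡ j) → m ≤ n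
relational-pigeonhole C total unique = injective⇒≤ {f = proj₁ ∘ total} λ {i} {j} eq →
  unique (subst (C i) eq (proj₂ (total i))) (proj₂ (total j))

unused-value : (f : Fin m → Fin (suc m)) → ∃ λ q → ∀ i → f i ≢ q
unused-value {m} f with all? (λ q → any? λ i → f i ≟ q)
... | yes onto = contradiction
  (relational-pigeonhole (λ q i → f i ≡ q) onto λ p q → trans (sym p) q) 1+n≰n
... | no ¬onto with q , ¬hit ← ¬∀⟶∃¬ (suc m) _ (λ q → any? λ i → f i ≟ q) ¬onto =
  q , λ i eq → ¬hit (i , eq)

injective⇒onto : (f : Fin m → Fin m) → Injective _≡_ _≡_ f → ∀ q → ∃ λ i → f i ≡ q
injective⇒onto {suc m} f f-inj q with any? (λ i → f i ≟ q)
... | yes hit = hit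
... | no ¬hit = contradiction
  (injective⇒≤ {f = λ i → punchOut (≢q i)} λ {i} {j} → f-inj ∘ punchOut-injective (≢q i) (≢q j))
  1+n≰n
  where
  ≢q : ∀ i → q ≢ f i
  ≢q i eq = ¬hit (i , sym eq)

elements : (p : Subset n) → ∃ λ (e : Fin ∣ p ∣ → Fin n) →
           Injective _≡_ _≡_ e × (∀ i → lookup p (e i) ≡ true) ×
           (∀ {w} → lookup p w ≡ true → ∃ λ i → e i ≡ w)
elements [] = (λ ()) , (λ { {()} }) , (λ ()) , λ { {()} }
elements (false ∷ p) with e , e-inj , e∈ , e-onto ← elements p =
  suc ∘ e , e-inj ∘ suc-injective , e∈ ,
  λ { {suc w} w∈ → let i , eq = e-onto w∈ in i , cong suc eq }
elements {suc n} (true ∷ p) with e , e-inj , e∈ , e-onto ← elements p =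
  e′ , e′-inj , (λ { zero → refl ; (suc i) → e∈ i }) ,
  λ { {zero}  _  → zero , refl
    ; {suc w} w∈ → let i , eq = e-onto w∈ in suc i , cong suc eq
    }
  where
  e′ : Fin (suc ∣ p ∣) → Fin (suc n)
  e′ zero    = zero
  e′ (suc i) = suc (e i)
  e′-inj : Injective _≡_ _≡_ e′
  e′-inj {zero}  {zero}  _  = refl
  e′-inj {suc i} {suc j} eq = cong suc (e-inj (suc-injective eq))

-- A property that can be established at any one point without being destroyed
-- elsewhere can be established everywhere.
sweep : {State : Set ℓ} (Good : State → Fin m → Set) →
        (∀ s u → ∃ λ s′ → Good s′ u × (∀ w → Good s w → Good s′ w)) →
        State → ∃ λ s → ∀ u → Good s u
sweep {m = zero}  Good fix s = s , λ ()
sweep {m = suc m} Good fix s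
  with s₁ , good ← sweep (λ s u → Good s (suc u))
         (λ s u → let s′ , g , keep = fix s (suc u) in s′ , g , keep ∘ suc) s
  with s₂ , g , keep ← fix s₁ zero
  = s₂ , λ { zero → g ; (suc u) → keep (suc u) (good u) }

-- Permutations adjusted by transpositions.

exchange : (π : Permutation′ m) (u w : Fin m) → ∃ λ (π′ : Permutation′ m) →
           π′ ⟨$⟩ʳ u ≡ π ⟨$⟩ʳ w × π′ ⟨$⟩ʳ w ≡ π ⟨$⟩ʳ u ×
           (∀ v → v ≢ u → v ≢ w → π′ ⟨$⟩ʳ v ≡ π ⟨$⟩ʳ v)
exchange π u w = π′ , at-u , at-w , elsewhere
  where
  π′ = transpose u w ∘ₚ π
  at-u : π′ ⟨$⟩ʳ u ≡ π ⟨$⟩ʳ w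
  at-u rewrite dec-true (u ≟ u) refl = refl
  at-w : π′ ⟨$⟩ʳ w ≡ π ⟨$⟩ʳ u
  at-w with w ≟ u
  ... | yes refl = refl
  ... | no _ rewrite dec-true (w ≟ w) refl = refl
  elsewhere : ∀ v → v ≢ u → v ≢ w → π′ ⟨$⟩ʳ v ≡ π ⟨$⟩ʳ v
  elsewhere v v≢u v≢w rewrite dec-false (v ≟ u) v≢u | dec-false (v ≟ w) v≢w = refl

permutation-injective : (π : Permutation′ m) → Injective _≡_ _≡_ (π ⟨$⟩ʳ_)
permutation-injective π eq = trans (sym (inverseˡ π)) (trans (cong (π ⟨$⟩ˡ_) eq) (inverseˡ π))

-- Each `u` in `P` is repaired by exchanging it with the point that currently takes the value `f u`.
-- That point is no other repaired `w` in `P`, since then `f w` would equal `f u`.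
extend-to-permutation : {P : Pred (Fin m) _} → Decidable P → (f : Fin m → Fin m) →
                        (∀ {u w} → P u → P w → f u ≡ f w → u ≡ w) →
                        ∃ λ (π : Permutation′ m) → ∀ u → P u → π ⟨$⟩ʳ u ≡ f u
extend-to-permutation {P = P} P? f f-inj = sweep (λ π u → P u → π ⟨$⟩ʳ u ≡ f u) fix idₚ
  where
  fix : ∀ π u → ∃ λ π′ → (P u → π′ ⟨$⟩ʳ u ≡ f u) ×
        (∀ w → (P w → π ⟨$⟩ʳ w ≡ f w) → P w → π′ ⟨$⟩ʳ w ≡ f w)
  fix π u with P? u
  ... | no ¬Pu = π , (λ Pu → contradiction Pu ¬Pu) , λ _ → id
  ... | yes Pu with π′ , at-u , _ , elsewhere ← exchange π u (π ⟨$⟩ˡ f u) =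
    π′ , const good-u , keep
    where
    good-u : π′ ⟨$⟩ʳ u ≡ f u
    good-u = trans at-u (inverseʳ π)
    keep : ∀ w → (P w → π ⟨$⟩ʳ w ≡ f w) → P w → π′ ⟨$⟩ʳ w ≡ f w
    keep w good Pw with w ≟ u
    ... | yes refl = good-u
    ... | no w≢u = trans (elsewhere w w≢u λ w≡ → w≢u (f-inj Pw Pu
            (trans (sym (good Pw)) (trans (cong (π ⟨$⟩ʳ_) w≡) (inverseʳ π))))) (good Pw)

-- The conflicts R j form a partial matching between points and values for each
-- j, and P has at most s points, one for each class Q a.
module _ {P : Fin m → Set} (P? : Decidable P)
         (Q : Fin s → Fin m → Set) (classify : ∀ {u} → P u → ∃ λ a → Q a u)
         (Q-unique : ∀ {a u w} → Q a u → Q a w → u ≡ w)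
         (R : Fin r → Fin m → Fin m → Set) (R? : ∀ j u q → Dec (R j u q))
         (R-functional : ∀ {j u q q′} → R j u q → R j u q′ → q ≡ q′)
         (R-injective : ∀ {j u w q} → R j u q → R j w q → u ≡ w)
         (room : s + (r + r) ≤ m)
  where

  private
    Partner : Permutation′ m → Fin m → Fin m → Set
    Partner π u w = ¬ P w × (∀ j → ¬ R j u (π ⟨$⟩ʳ w)) × (∀ j → ¬ R j w (π ⟨$⟩ʳ u))

    partner? : ∀ π u → Decidable (Partner π u)
    partner? π u w = ¬? (P? w) ×-dec all? (λ j → ¬? (R? j u _)) ×-dec all? (λ j → ¬? (R? j w _))

  -- Every non-partner is blocked by a point class or by one of the two kinds of
  -- conflict. As u itself, in conflict through j₀, is blocked in both ways, the
  -- extra pigeon zero may occupy the second of these holes.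
  partner : ∀ π u j₀ → R j₀ u (π ⟨$⟩ʳ u) → ∃ (Partner π u)
  partner π u j₀ clash with any? (partner? π u)
  ... | yes found = found
  ... | no none = contradiction (relational-pigeonhole
      (λ i → Blocks i ∘ holes) blocked λ {i} {j} {a} → blocks-unique i j (holes a)) (≤⇒≯ room)
    where
    Hole : Set
    Hole = Fin s ⊎ (Fin r ⊎ Fin r)

    holes : Fin (s + (r + r)) → Hole
    holes = [ inj₁ , inj₂ ∘ splitAt r ]′ ∘ splitAt s

    holes-onto : ∀ h → ∃ λ a → holes a ≡ h
    holes-onto (inj₁ a) = join s (r + r) (inj₁ a) ,
      cong [ inj₁ , inj₂ ∘ splitAt r ]′ (splitAt-join s (r + r) (inj₁ a))
    holes-onto (inj₂ h) = join s (r + r) (inj₂ (join r r h)) ,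
      trans (cong [ inj₁ , inj₂ ∘ splitAt r ]′ (splitAt-join s (r + r) (inj₂ (join r r h))))
            (cong inj₂ (splitAt-join r r h))

    Blocks : Fin (suc m) → Hole → Set
    Blocks zero    h               = h ≡ inj₂ (inj₂ j₀)
    Blocks (suc w) (inj₁ a)        = Q a w
    Blocks (suc w) (inj₂ (inj₁ j)) = R j u (π ⟨$⟩ʳ w)
    Blocks (suc w) (inj₂ (inj₂ j)) = w ≢ u × R j w (π ⟨$⟩ʳ u)

    hole : ∀ w → ∃ (Blocks (suc w))
    hole w with P? w
    ... | yes Pw = let a , q = classify Pw in inj₁ a , q
    ... | no ¬Pw with any? (λ j → R? j u (π ⟨$⟩ʳ w)) | any? (λ j → R? j w (π ⟨$⟩ʳ u))
    ... | yes (j , c) | _           = inj₂ (inj₁ j) , c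
    ... | no ¬c       | yes (j , c) = inj₂ (inj₂ j) , (λ { refl → ¬c (j , c) }) , c
    ... | no ¬c       | no ¬c′      =
      contradiction (w , ¬Pw , (λ j c → ¬c (j , c)) , λ j c → ¬c′ (j , c)) none

    blocked : ∀ i → ∃ (Blocks i ∘ holes)
    blocked zero = holes-onto (inj₂ (inj₂ j₀))
    blocked (suc w) = let h , b = hole w ; a , eq = holes-onto h in a , subst (Blocks (suc w)) (sym eq) b

    blocks-unique : ∀ i j h → Blocks i h → Blocks j h → i ≡ j
    blocks-unique zero    zero     _               _         _         = refl
    blocks-unique zero    (suc w)  _               refl      (w≢u , c) = contradiction (R-injective c clash) w≢u
    blocks-unique (suc w) zero     _               (w≢u , c) refl      = contradiction (R-injective c clash) w≢u
    blocks-unique (suc w) (suc w′) (inj₁ a)        b         b′        = cong suc (Q-unique b b′)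
    blocks-unique (suc w) (suc w′) (inj₂ (inj₁ j)) b         b′        = cong suc (permutation-injective π (R-functional b b′))
    blocks-unique (suc w) (suc w′) (inj₂ (inj₂ j)) (_ , b)   (_ , b′)  = cong suc (R-injective b b′)

  -- Starting from an extension of `f`, each clashing `u` outside `P` is exchanged with a partner.
  -- The partner lies outside `P` too, so agreement with `f` survives; both moved points end up free
  -- of conflicts and all others keep their values.
  avoid-conflicts : (f : Fin m → Fin m) → (∀ {u w} → P u → P w → f u ≡ f w → u ≡ w) →
                    ∃ λ (π : Permutation′ m) → (∀ u → P u → π ⟨$⟩ʳ u ≡ f u) ×
                    (∀ u → ¬ P u → ∀ j → ¬ R j u (π ⟨$⟩ʳ u))
  avoid-conflicts f f-inj =
    let (π , agree) , good = sweep Good fix (extend-to-permutation P? f f-inj) in π , agree , good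
    where
    State : Set
    State = ∃ λ (π : Permutation′ m) → ∀ u → P u → π ⟨$⟩ʳ u ≡ f u

    Good : State → Fin m → Set
    Good (π , _) u = ¬ P u → ∀ j → ¬ R j u (π ⟨$⟩ʳ u)

    fix : ∀ s u → ∃ λ s′ → Good s′ u × (∀ w → Good s w → Good s′ w)
    fix (π , agree) u with P? u | any? (λ j → R? j u (π ⟨$⟩ʳ u))
    ... | yes Pu | _     = (π , agree) , (λ ¬Pu → contradiction Pu ¬Pu) , λ _ → id
    ... | no _   | no ¬c = (π , agree) , (λ _ j c → ¬c (j , c)) , λ _ → id
    ... | no ¬Pu | yes (j₀ , clash)
      with w , ¬Pw , free-u , free-w ← partner π u j₀ clash
      with π′ , at-u , at-w , elsewhere ← exchange π u w
      = (π′ , agree′) , good-u , keep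
      where
      agree′ : ∀ v → P v → π′ ⟨$⟩ʳ v ≡ f v
      agree′ v Pv = trans (elsewhere v (λ { refl → ¬Pu Pv }) λ { refl → ¬Pw Pv }) (agree v Pv)
      good-u : Good (π′ , agree′) u
      good-u _ j c = free-u j (subst (R j u) at-u c)
      keep : ∀ v → Good (π , agree) v → Good (π′ , agree′) v
      keep v good with v ≟ u | v ≟ w
      ... | yes refl | _        = good-u
      ... | no _     | yes refl = λ _ j c → free-w j (subst (R j w) at-w c)
      ... | no v≢u   | no v≢w   = λ ¬Pv j c → good ¬Pv j (subst (R j v) (elsewhere v v≢u v≢w) c)

-- Walks and a pair of distant vertices.

walk-++ : {G : Graph n} → ∀ {k l u v w} → Walk G k u v → Walk G l v w → Walk G (k + l) u w
walk-++ nil        q = q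
walk-++ (cons a p) q = cons a (walk-++ p q)

walk-snoc : {G : Graph n} → ∀ {k u v w} → Walk G k u v → Adj G v w → Walk G (suc k) u w
walk-snoc nil        b = cons b nil
walk-snoc (cons a p) b = cons a (walk-snoc p b)

walk-reverse : {G : Graph n} → ∀ {k u v} → Walk G k u v → Walk G k v u
walk-reverse nil = nil
walk-reverse {G = G} (cons a p) = walk-snoc (walk-reverse p) (adj-sym G a)

walk? : (G : Graph n) → ∀ k u v → Dec (Walk G k u v)
walk? G zero    u v = map′ (λ { refl → nil }) (λ { nil → refl }) (u ≟ v)
walk? G (suc k) u v = map′ (λ { (_ , a , p) → cons a p }) (λ { (cons a p) → _ , a , p })
  (any? λ w → adj? G u w ×-dec walk? G k w v)

-- If every pair were joined by a walk of length at most 5, then 5 would bound all distances,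
-- against the leastness of `D`. Existence of a walk of given length is decidable, so a pair can be
-- searched for. In terms of walks, a pair at infinite distance qualifies vacuously.
distant-pair : (G : Graph n) {D : ℕ∞} → IsDiameter G D → [ 6 ] ≤∞ D →
               ∃₂ λ x y → ∀ {l} → Walk G l x y → 6 ≤ l
distant-pair {n} G {D} (_ , least) 6≤D = search (all? λ u → all? (close? u))
  where
  Close : Fin n → Fin n → Set
  Close u v = ∃ λ (i : Fin 6) → Walk G (toℕ i) u v

  close? : ∀ u v → Dec (Close u v)
  close? u v = any? λ i → walk? G (toℕ i) u v

  bound : (∀ u v → Close u v) → BoundsDistances G [ 5 ]
  bound close u v _ (finite _ shortest) = let i , p = close u v in [ ≤-trans (shortest p) (s≤s⁻¹ (toℕ<n i)) ]
  bound close u v _ (infinite none)     = let _ , p = close u v in contradiction p none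

  too-small : ∀ {D} → [ 6 ] ≤∞ D → ¬ D ≤∞ [ 5 ]
  too-small [ 6≤k ] [ k≤5 ] = 1+n≰n (≤-trans 6≤k k≤5)

  search : Dec (∀ u v → Close u v) → ∃₂ λ x y → ∀ {l} → Walk G l x y → 6 ≤ l
  search (yes close) = contradiction (least [ 5 ] (bound close)) (too-small 6≤D)
  search (no ¬close)
    with x , ¬close-x ← ¬∀⟶∃¬ n _ (λ u → all? (close? u)) ¬close
    with y , ¬close-xy ← ¬∀⟶∃¬ n _ (close? x) ¬close-x
    = x , y , λ {l} p → ≮⇒≥ λ l<6 →
        ¬close-xy (fromℕ< l<6 , subst (λ k → Walk G k x y) (sym (toℕ-fromℕ< l<6)) p)

-- Neighbourhoods and 4-cycles.

abstract
  neighbour-enumeration : ∀ d (G : Graph n) → Regular d G → ∀ v → ∃ λ (e : Fin d → Fin n) →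
    Injective _≡_ _≡_ e × (∀ i → Adj G v (e i)) × (∀ {w} → Adj G v w → ∃ λ i → e i ≡ w)
  neighbour-enumeration {n} d G reg v = subst Enumeration (reg v)
    (let e , e-inj , e∈ , e-onto = elements (neighbours G v)
     in e , e-inj , (λ i → sound (e∈ i)) , e-onto ∘ complete)
    where
    Enumeration : ℕ → Set
    Enumeration k = ∃ λ (e : Fin k → Fin n) →
      Injective _≡_ _≡_ e × (∀ i → Adj G v (e i)) × (∀ {w} → Adj G v w → ∃ λ i → e i ≡ w)

    sound : ∀ {w} → lookup (neighbours G v) w ≡ true → Adj G v w
    sound {w} eq with adj? G v w | trans (sym (lookup∘tabulate (λ w → ⌊ adj? G v w ⌋) w)) eq
    ... | yes a | _ = a

    complete : ∀ {w} → Adj G v w → lookup (neighbours G v) w ≡ true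
    complete {w} a = trans (lookup∘tabulate _ w)
      (trans (isYes≗does (adj? G v w)) (dec-true (adj? G v w) a))

-- Otherwise `a`, `u`, `b`, `w` would form a 4-cycle; consecutive vertices differ by irreflexivity,
-- opposite ones by `a≢b` and `u≢w`. The absence of 4-cycles enters the proof only here.
unique-common-neighbour : (G : Graph n) → ¬ Contains G C₄ → ∀ {a b u w} → a ≢ b →
  Adj G a u → Adj G b u → Adj G a w → Adj G b w → u ≡ w
unique-common-neighbour {n} G no-C₄ {a} {b} {u} {w} a≢b au bu aw bw with u ≟ w
... | yes eq = eq
... | no u≢w = ⊥-elim (no-C₄ (f , (λ {i} {j} → f-inj {i} {j}) , f-hom))
  where
  f : Fin 4 → Fin n
  f 0F = a
  f 1F = u
  f 2F = b
  f 3F = w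
  distinct : ∀ {v v′} → Adj G v v′ → v ≢ v′
  distinct vv refl = irrefl G _ vv
  f-inj : Injective _≡_ _≡_ f
  f-inj {0F} {0F} _  = refl
  f-inj {0F} {1F} eq = contradiction eq (distinct au)
  f-inj {0F} {2F} eq = contradiction eq a≢b
  f-inj {0F} {3F} eq = contradiction eq (distinct aw)
  f-inj {1F} {0F} eq = contradiction (sym eq) (distinct au)
  f-inj {1F} {1F} _  = refl
  f-inj {1F} {2F} eq = contradiction (sym eq) (distinct bu)
  f-inj {1F} {3F} eq = contradiction eq u≢w
  f-inj {2F} {0F} eq = contradiction (sym eq) a≢b
  f-inj {2F} {1F} eq = contradiction eq (distinct bu)
  f-inj {2F} {2F} _  = refl
  f-inj {2F} {3F} eq = contradiction eq (distinct bw)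
  f-inj {3F} {0F} eq = contradiction (sym eq) (distinct aw)
  f-inj {3F} {1F} eq = contradiction (sym eq) u≢w
  f-inj {3F} {2F} eq = contradiction (sym eq) (distinct bw)
  f-inj {3F} {3F} _  = refl
  next : ∀ i j → Next₄ i j → Adj G (f i) (f j)
  next 0F 1F _ = au
  next 1F 2F _ = adj-sym G bu
  next 2F 3F _ = bw
  next 3F 0F _ = adj-sym G aw
  f-hom : ∀ {i j} → SymClosure Next₄ i j → Adj G (f i) (f j)
  f-hom (fwd e) = next _ _ e
  f-hom (bwd e) = adj-sym G (next _ _ e)

-- Closed neighbourhoods, rainbow vertices and greedy colouring.

module RegularGraph {n} (d : ℕ) (G : Graph n) (reg : Regular d G) where

  infix 4 _~_
  _~_ : Fin n → Fin n → Set
  _~_ = Adj G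

  Colour : Set
  Colour = Fin (suc d)

  neighbour : Fin n → Fin d → Fin n
  neighbour v = proj₁ (neighbour-enumeration d G reg v)

  neighbour-injective : ∀ v → Injective _≡_ _≡_ (neighbour v)
  neighbour-injective v = proj₁ (proj₂ (neighbour-enumeration d G reg v))

  neighbour~ : ∀ v i → v ~ neighbour v i
  neighbour~ v = proj₁ (proj₂ (proj₂ (neighbour-enumeration d G reg v)))

  neighbour-onto : ∀ {v w} → v ~ w → ∃ λ i → neighbour v i ≡ w
  neighbour-onto {v} = proj₂ (proj₂ (proj₂ (neighbour-enumeration d G reg v)))

  Star : Fin n → Fin n → Set
  Star v w = w ≡ v ⊎ v ~ w

  star? : ∀ v → Decidable (Star v)
  star? v w = w ≟ v ⊎-dec adj? G v w

  star : Fin n → Fin (suc d) → Fin n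
  star v zero    = v
  star v (suc i) = neighbour v i

  star∈ : ∀ {v} i → Star v (star v i)
  star∈ zero    = inj₁ refl
  star∈ (suc i) = inj₂ (neighbour~ _ i)

  star-injective : ∀ {v} → Injective _≡_ _≡_ (star v)
  star-injective {v} {zero}  {zero}  _  = refl
  star-injective {v} {zero}  {suc j} eq = contradiction (subst (v ~_) (sym eq) (neighbour~ v j)) (irrefl G v)
  star-injective {v} {suc i} {zero}  eq = contradiction (subst (v ~_) eq (neighbour~ v i)) (irrefl G v)
  star-injective {v} {suc i} {suc j} eq = cong suc (neighbour-injective v eq)

  star-onto : ∀ {v w} → Star v w → ∃ λ i → star v i ≡ w
  star-onto (inj₁ refl) = zero , refl
  star-onto (inj₂ v~w)  = let i , eq = neighbour-onto v~w in suc i , eq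

  overwrite : ∀ v (g : Fin (suc d) → Colour) (c : Fin n → Colour) → ∃ λ c′ →
              (∀ i → c′ (star v i) ≡ g i) × (∀ {w} → ¬ Star v w → c′ w ≡ c w)
  overwrite v g c = c′ , inside , outside
    where
    c′ : Fin n → Colour
    c′ w with star? v w
    ... | yes p = g (proj₁ (star-onto p))
    ... | no _  = c w
    inside : ∀ i → c′ (star v i) ≡ g i
    inside i with star? v (star v i)
    ... | yes p = cong g (star-injective (proj₂ (star-onto p)))
    ... | no ¬p = contradiction (star∈ i) ¬p
    outside : ∀ {w} → ¬ Star v w → c′ w ≡ c w
    outside {w} ¬p with star? v w
    ... | yes p = contradiction p ¬p
    ... | no _  = refl

  ProperOn : Pred (Fin n) _ → (Fin n → Colour) → Set
  ProperOn P c = ∀ {a b} → P a → P b → a ~ b → c a ≢ c b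

  -- A closed neighbourhood has exactly `d + 1` vertices, so injectivity on it amounts to `v` seeing
  -- every colour but its own. This form passes between colourings that agree on the star and gives
  -- properness inside it.
  Rainbow : (Fin n → Colour) → Fin n → Set
  Rainbow c v = ∀ {a b} → Star v a → Star v b → c a ≡ c b → a ≡ b

  injective⇒rainbow : ∀ {c v} {g : Fin (suc d) → Colour} → Injective _≡_ _≡_ g →
                      (∀ i → c (star v i) ≡ g i) → Rainbow c v
  injective⇒rainbow {v = v} g-inj at-v a∈ b∈ eq
    with i , refl ← star-onto a∈ | j , refl ← star-onto b∈ =
    cong (star v) (g-inj (trans (sym (at-v i)) (trans eq (at-v j))))

  rainbow⇒b-vertex : ∀ {c v} → Rainbow c v → ∀ j → j ≢ c v → ∃ λ w → v ~ w × c w ≡ j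
  rainbow⇒b-vertex {c} {v} rainbow j j≢
    with injective⇒onto (c ∘ star v) (λ {i} {k} → star-injective ∘ rainbow (star∈ i) (star∈ k)) j
  ... | zero  , eq = contradiction (sym eq) j≢
  ... | suc i , eq = neighbour v i , neighbour~ v i , eq

  -- A b-vertex of the first colour sees the `l` others at distinct vertices among its `d`
  -- neighbours.
  b-colouring-bound : ∀ l → HasBColouring G l → l ≤ suc d
  b-colouring-bound zero    _ = z≤n
  b-colouring-bound (suc l) (c , _ , b-vertex) with v , cv≡ , sees ← b-vertex zero =
    s≤s (relational-pigeonhole (λ j i → c (neighbour v i) ≡ suc j) total
      λ p q → suc-injective (trans (sym p) q))
    where
    total : ∀ j → ∃ λ i → c (neighbour v i) ≡ suc j
    total j with w , v~w , cw≡ ← sees (suc j) (λ ()) with i , eq ← neighbour-onto v~w =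
      i , trans (cong c eq) cw≡

  greedy-extension : {P : Pred (Fin n) _} → Decidable P → ∀ c → ProperOn P c →
                     ∃ λ c′ → ProperColouring G (suc d) c′ × (∀ {w} → P w → c′ w ≡ c w)
  greedy-extension {P} P? c proper =
    let state , coloured = sweep Dom step initial in
    State.colour state , State.proper′ state (coloured _) (coloured _) , State.agree state
    where
    record State : Set₁ where
      field
        Dom     : Pred (Fin n) _
        dom?    : Decidable Dom
        colour  : Fin n → Colour
        proper′ : ProperOn Dom colour
        P⊆Dom   : ∀ {w} → P w → Dom w
        agree   : ∀ {w} → P w → colour w ≡ c w
    open State using (Dom)

    initial : State
    initial = record
      { Dom = P ; dom? = P? ; colour = c ; proper′ = proper ; P⊆Dom = id ; agree = λ _ → refl }

    step : ∀ s u → ∃ λ s′ → Dom s′ u × (∀ w → Dom s w → Dom s′ w)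
    -- The colours of all `d` neighbours are avoided, even the arbitrary ones outside `Dom s`; one
    -- of `d + 1` colours still remains.
    step s u with State.dom? s u | unused-value (State.colour s ∘ neighbour u)
    ... | yes u∈ | _ = s , u∈ , λ _ → id
    ... | no u∉  | q , unused = s′ , inj₂ refl , λ _ → inj₁
      where
      open State s hiding (Dom)
      colour′ = updateAt colour u (const q)
      at-u : colour′ u ≡ q
      at-u = updateAt-updates u colour
      unchanged : ∀ {w} → Dom s w → colour′ w ≡ colour w
      unchanged w∈ = updateAt-minimal _ u colour λ { refl → u∉ w∈ }
      new : ∀ {w} → Dom s w → u ~ w → q ≢ colour′ w
      new w∈ u~w eq with i , refl ← neighbour-onto u~w = unused i (sym (trans eq (unchanged w∈)))
      s′ : State
      s′ = record
        { Dom     = λ w → Dom s w ⊎ w ≡ u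
        ; dom?    = λ w → dom? w ⊎-dec w ≟ u
        ; colour  = colour′
        ; proper′ = λ where
            (inj₁ a∈)   (inj₁ b∈)   a~b eq → proper′ a∈ b∈ a~b (trans (sym (unchanged a∈)) (trans eq (unchanged b∈)))
            (inj₁ a∈)   (inj₂ refl) a~u eq → new a∈ (adj-sym G a~u) (trans (sym at-u) (sym eq))
            (inj₂ refl) (inj₁ b∈)   u~b eq → new b∈ u~b (trans (sym at-u) eq)
            (inj₂ refl) (inj₂ refl) u~u _  → irrefl G u u~u
        ; P⊆Dom   = inj₁ ∘ P⊆Dom
        ; agree   = λ w∈ → trans (unchanged (P⊆Dom w∈)) (agree w∈)
        }

  -- Making neighbours of a vertex rainbow, one at a time.

  module _ (no-C₄ : ¬ Contains G C₄) where

    Stars : Fin n → (Fin r → Fin n) → Fin n → Set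
    Stars x t w = Star x w ⊎ ∃ λ j → Star (t j) w

    -- Colouring the star of `x` by position determines which colours the rainbow vertices `t j`
    -- carry. Colours outside the stars are arbitrary.
    StarColouring : Fin n → (Fin r → Fin n) → (Fin n → Colour) → Set
    StarColouring x t c =
      (∀ i → c (star x i) ≡ i) × (∀ j → Rainbow c (t j)) × ProperOn (Stars x t) c

    module _ {x : Fin n} {t : Fin (suc r) → Fin n} (t-inj : Injective _≡_ _≡_ t)
             (x~t : ∀ j → x ~ t j) (room : suc r + suc r ≤ d)
             {c : Fin n → Colour} (star-colouring : StarColouring x (t ∘ suc) c) where

      private
        v = t zero
        t′ = t ∘ suc
        at-x    = proj₁ star-colouring
        rainbow = proj₁ (proj₂ star-colouring)
        proper  = proj₂ (proj₂ star-colouring)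

        common : ∀ {a b u w} → a ≢ b → a ~ u → b ~ u → a ~ w → b ~ w → u ≡ w
        common = unique-common-neighbour G no-C₄

        ~sym : ∀ {a b} → a ~ b → b ~ a
        ~sym = adj-sym G

        v≢t′ : ∀ j → v ≢ t′ j
        v≢t′ j eq with () ← t-inj eq

        v≢x : v ≢ x
        v≢x eq = irrefl G x (subst (x ~_) eq (x~t zero))

        rainbow-x : Rainbow c x
        rainbow-x = injective⇒rainbow id at-x

        Fixed : Fin (suc d) → Set
        Fixed i = Star x (star v i)

        -- The positions that are already coloured fall into three classes of at most one element:
        -- `v`, `x` and the common neighbour of the two.
        Kind : Fin 3 → Fin (suc d) → Set
        Kind 0F i = star v i ≡ v
        Kind 1F i = star v i ≡ x
        Kind 2F i = v ~ star v i × x ~ star v i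

        classify : ∀ {i} → Fixed i → ∃ λ a → Kind a i
        classify {i} (inj₁ eq) = 1F , eq
        classify {i} (inj₂ x~) with star∈ {v} i
        ... | inj₁ eq = 0F , eq
        ... | inj₂ v~ = 2F , v~ , x~

        kind-unique : ∀ {a i j} → Kind a i → Kind a j → i ≡ j
        kind-unique {0F} p q = star-injective (trans p (sym q))
        kind-unique {1F} p q = star-injective (trans p (sym q))
        kind-unique {2F} (v~i , x~i) (v~j , x~j) = star-injective (common v≢x v~i x~i v~j x~j)

        v~ : ∀ {a} → Star v a → ¬ Star x a → v ~ a
        v~ (inj₁ refl) a∉ = contradiction (inj₂ (x~t zero)) a∉
        v~ (inj₂ v~a)  _  = v~a

        -- The clause `w ≢ v` is what makes conflicts injective in the position; an edge to `v`
        -- itself lies inside the new star, where a permutation of the colours cannot clash.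
        Conflict : Fin r → Fin (suc d) → Colour → Set
        Conflict j i q = ¬ Fixed i × ∃ λ w → t′ j ~ w × w ≢ v × w ~ star v i × c w ≡ q

        conflict? : ∀ j i q → Dec (Conflict j i q)
        conflict? j i q = ¬? (star? x _) ×-dec any? λ w →
          adj? G _ w ×-dec ¬? (w ≟ v) ×-dec adj? G w _ ×-dec c w ≟ q

        -- As `star v i` is not adjacent to `x`, it differs from `t′ j`. So `w` is their only common
        -- neighbour, and its colour is determined.
        conflict-functional : ∀ {j i q q′} → Conflict j i q → Conflict j i q′ → q ≡ q′
        conflict-functional {j} (i∉ , w , t~w , _ , w~ , refl) (_ , w′ , t~w′ , _ , w′~ , refl) =
          cong c (common (λ eq → i∉ (inj₂ (subst (x ~_) eq (x~t (suc j))))) t~w (~sym w~) t~w′ (~sym w′~))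

        -- As `t′ j` is rainbow, the colour determines `w`; then `star v i` is the only common
        -- neighbour of `w` and `v`.
        conflict-injective : ∀ {j i i′ q} → Conflict j i q → Conflict j i′ q → i ≡ i′
        conflict-injective {j} {i} {i′} (i∉ , w , t~w , w≢v , w~ , eq) (i′∉ , w′ , t~w′ , _ , w′~ , eq′)
          with refl ← rainbow j (inj₂ t~w) (inj₂ t~w′) (trans eq (sym eq′)) =
          star-injective (common w≢v w~ (v~ (star∈ i) i∉) w′~ (v~ (star∈ i′) i′∉))

        enough : 3 + (r + r) ≤ suc d
        -- `room` amounts to `2 + (r + r) ≤ d`; the centre `v` supplies the additional position.
        enough = s≤s (subst (_≤ d) (cong suc (+-suc r r)) room)

        abstract
          repaired : ∃ λ (π : Permutation′ (suc d)) →
                     (∀ i → Fixed i → π ⟨$⟩ʳ i ≡ c (star v i)) ×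
                     (∀ i → ¬ Fixed i → ∀ j → ¬ Conflict j i (π ⟨$⟩ʳ i))
          repaired = avoid-conflicts (star? x ∘ star v) Kind (λ {u} → classify {u})
            (λ {a} → kind-unique {a}) Conflict conflict?
            (λ {j} {i} → conflict-functional {j} {i}) (λ {j} {i} → conflict-injective {j} {i}) enough
            (c ∘ star v) λ {i} {j} p q eq → star-injective {v} {i} {j} (rainbow-x p q eq)

      -- The repaired permutation is written onto the star of `v`. Old colours survive, because old
      -- stars meet the new one only inside the star of `x`, where the permutation agrees with `c`.
      -- Only edges between the new star and old ones then need an argument.
      add-star : ∃ (StarColouring x t)
      add-star with π , agree , conflict-free ← repaired
               with c′ , at-v , elsewhere ← overwrite v (π ⟨$⟩ʳ_) c
        = c′ , (λ i → trans (keep (inj₁ (star∈ i))) (at-x i)) , rainbow′ , proper′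
        where
        -- `t′ j` itself is adjacent to `x`; any other `w` outside the star of `x` would be a second
        -- common neighbour of `v` and `t′ j` besides `x`.
        shared : ∀ {w} → Star v w → Stars x t′ w → Star x w
        shared w∈v (inj₁ w∈x) = w∈x
        shared w∈v (inj₂ (j , inj₁ refl)) = inj₂ (x~t (suc j))
        shared {w} w∈v (inj₂ (j , inj₂ t~w)) with star? x w
        ... | yes w∈x = w∈x
        ... | no w∉x  = inj₁ (common (v≢t′ j) (v~ w∈v w∉x) t~w (~sym (x~t zero)) (~sym (x~t (suc j))))

        keep : ∀ {w} → Stars x t′ w → c′ w ≡ c w
        keep {w} w∈ with star? v w
        ... | no w∉v = elsewhere w∉v
        ... | yes w∈v with i , refl ← star-onto w∈v = trans (at-v i) (agree i (shared w∈v w∈))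

        rainbow-v : Rainbow c′ v
        rainbow-v = injective⇒rainbow (permutation-injective π) at-v

        rainbow′ : ∀ j → Rainbow c′ (t j)
        rainbow′ zero = rainbow-v
        rainbow′ (suc j) a∈ b∈ eq = rainbow j a∈ b∈
          (trans (sym (keep (inj₂ (j , a∈)))) (trans eq (keep (inj₂ (j , b∈)))))

        split : ∀ {w} → Stars x t w → Star v w ⊎ Stars x t′ w
        split (inj₁ w∈)           = inj₂ (inj₁ w∈)
        split (inj₂ (zero , w∈))  = inj₁ w∈
        split (inj₂ (suc j , w∈)) = inj₂ (inj₂ (j , w∈))

        proper-v : ProperOn (Star v) c′
        proper-v a∈ b∈ a~b eq with refl ← rainbow-v a∈ b∈ eq = irrefl G _ a~b

        proper-old : ProperOn (Stars x t′) c′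
        proper-old a∈ b∈ a~b eq = proper a∈ b∈ a~b (trans (sym (keep a∈)) (trans eq (keep b∈)))

        -- If `a` is outside the star of `x` and `b` outside that of `v`, then `b` is not in the
        -- star of `x` either. Hence it is a neighbour of some `t′ j`, and `conflict-free` applies.
        proper-mixed : ∀ {a b} → Star v a → Stars x t′ b → a ~ b → c′ a ≢ c′ b
        proper-mixed {a} {b} a∈v b∈ a~b with star? x a | star? v b
        ... | yes a∈x | _       = proper-old (inj₁ a∈x) b∈ a~b
        ... | no _    | yes b∈v = proper-v a∈v b∈v a~b
        ... | no a∉x  | no b∉v  = outside b∈
          where
          x≁b : ¬ x ~ b
          -- Otherwise `b` and `v` are common neighbours of `a` and `x`, whence `b ≡ v`.
          x≁b x~b = b∉v (inj₁ (common (a∉x ∘ inj₁) a~b x~b (~sym (v~ a∈v a∉x)) (x~t zero)))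
          outside : Stars x t′ b → c′ a ≢ c′ b
          outside (inj₁ (inj₁ refl))       _  = a∉x (inj₂ (~sym a~b))
          outside (inj₁ (inj₂ x~b))        _  = x≁b x~b
          outside (inj₂ (j , inj₁ refl))   _  = x≁b (x~t (suc j))
          outside (inj₂ (j , inj₂ t~b))    eq with i , refl ← star-onto a∈v =
            conflict-free i a∉x j (a∉x , b , t~b , (λ b≡v → b∉v (inj₁ b≡v)) , ~sym a~b ,
              trans (sym (keep b∈)) (trans (sym eq) (at-v i)))

        proper′ : ProperOn (Stars x t) c′
        proper′ a∈ b∈ a~b with split a∈ | split b∈
        ... | inj₁ a∈v | inj₁ b∈v = proper-v a∈v b∈v a~b
        ... | inj₁ a∈v | inj₂ b∈′ = proper-mixed a∈v b∈′ a~b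
        ... | inj₂ a∈′ | inj₁ b∈v = proper-mixed b∈v a∈′ (~sym a~b) ∘ sym
        ... | inj₂ a∈′ | inj₂ b∈′ = proper-old a∈′ b∈′ a~b

    star-colouring : ∀ r x (t : Fin r → Fin n) → Injective _≡_ _≡_ t → (∀ j → x ~ t j) →
                     r + r ≤ d → ∃ (StarColouring x t)
    -- The default colour `zero` is taken only outside the star of `x`, where properness is not yet
    -- claimed.
    star-colouring zero x t _ _ _ with c , at-x , _ ← overwrite x id (const zero) =
      c , at-x , (λ ()) , proper
      where
      proper : ProperOn (Stars x t) c
      proper (inj₁ a∈) (inj₁ b∈) a~b eq
        with refl ← injective⇒rainbow id at-x a∈ b∈ eq = irrefl G _ a~b
    star-colouring (suc r) x t t-inj x~t room =
      add-star t-inj x~t room (proj₂ (star-colouring r x (t ∘ suc) (suc-injective ∘ t-inj) (x~t ∘ suc)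
        (≤-trans (+-mono-≤ (n≤1+n r) (n≤1+n r)) room)))

    -- Gluing the colourings around two distant vertices.

    record Seed (x : Fin n) : Set₁ where
      field
        Dom    : Pred (Fin n) _
        dom?   : Decidable Dom
        near   : ∀ {w} → Dom w → ∃ λ l → l ≤ 2 × Walk G l x w
        colour : Fin n → Colour
        proper : ProperOn Dom colour
        centre : ∀ i → toℕ i ≤ ⌊ d /2⌋ → ∃ λ v →
                 colour v ≡ i × Rainbow colour v × (∀ {w} → Star v w → Dom w)

    -- The first `⌊ d /2⌋` neighbours of `x` become rainbow, as many as `r + r ≤ d` allows. Together
    -- with `x` they carry the colours from 0 to `⌊ d /2⌋`. Their stars lie in `Dom`, so a later
    -- extension leaves them intact.
    seed : ∀ x → Seed x
    seed x = let c , at-x , rainbow , proper = colouring in record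
      { Dom    = Stars x t
      ; dom?   = λ w → star? x w ⊎-dec any? λ j → star? (t j) w
      ; near   = near
      ; colour = c
      ; proper = proper
      ; centre = centre c at-x rainbow
      }
      where
      t : Fin ⌊ d /2⌋ → Fin n
      t j = neighbour x (inject≤ j (⌊n/2⌋≤n d))

      colouring : ∃ (StarColouring x t)
      colouring = star-colouring ⌊ d /2⌋ x t
        (λ eq → inject≤-injective _ _ _ _ (neighbour-injective x eq)) (λ j → neighbour~ x _)
        (≤-trans (+-monoʳ-≤ ⌊ d /2⌋ (⌊n/2⌋≤⌈n/2⌉ d)) (≤-reflexive (⌊n/2⌋+⌈n/2⌉≡n d)))

      near : ∀ {w} → Stars x t w → ∃ λ l → l ≤ 2 × Walk G l x w
      near (inj₁ (inj₁ refl))     = 0 , z≤n , nil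
      near (inj₁ (inj₂ x~w))      = 1 , s≤s z≤n , cons x~w nil
      near (inj₂ (j , inj₁ refl)) = 1 , s≤s z≤n , cons (neighbour~ x _) nil
      near (inj₂ (j , inj₂ t~w))  = 2 , ≤-refl , cons (neighbour~ x _) (cons t~w nil)

      centre : ∀ c → (∀ i → c (star x i) ≡ i) → (∀ j → Rainbow c (t j)) →
               ∀ i → toℕ i ≤ ⌊ d /2⌋ → ∃ λ v →
               c v ≡ i × Rainbow c v × (∀ {w} → Star v w → Stars x t w)
      centre c at-x _ zero _ = x , at-x zero , injective⇒rainbow id at-x , inj₁
      -- The vertex `t j` has position `suc j` in the star of `x`, so the bound on `suc i` is
      -- exactly the strict bound on `i` that `fromℕ<` takes.
      centre c at-x rainbow (suc i) i<k = t j , trans (cong (c ∘ star x ∘ suc) j≡i) (at-x (suc i)) ,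
        rainbow j , λ w∈ → inj₂ (j , w∈)
        where
        j = fromℕ< i<k
        j≡i : inject≤ j (⌊n/2⌋≤n d) ≡ i
        j≡i = toℕ-injective (trans (toℕ-inject≤ j _) (toℕ-fromℕ< i<k))

    -- Both seeds provide b-vertices for the low colours; reversing the palette around `y` turns its
    -- share into the high ones.
    b-colouring : ∀ {x y} → (∀ {l} → Walk G l x y → 6 ≤ l) → HasBColouring G (suc d)
    b-colouring {x} {y} far = c′ , c′-proper , b-vertex
      where
      module X = Seed (seed x)
      module Y = Seed (seed y)

      short : ∀ {a b} → Star a b → ∃ λ e → e ≤ 1 × Walk G e a b
      short (inj₁ refl) = 0 , z≤n , nil
      short (inj₂ a~b)  = 1 , ≤-refl , cons a~b nil

      -- A connecting walk would have length at most 2 + 1 + 2, which is less than 6. Using `Star`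
      -- treats overlap of the two domains and edges between them at once.
      apart : ∀ {a b} → X.Dom a → Y.Dom b → ¬ Star a b
      apart a∈ b∈ b∈star
        with k , k≤2 , p ← X.near a∈ | l , l≤2 , q ← Y.near b∈ | e , e≤1 , s ← short b∈star
        = <⇒≱ (far (walk-++ p (walk-++ s (walk-reverse q)))) (+-mono-≤ k≤2 (+-mono-≤ e≤1 l≤2))

      mirrored : Fin n → Colour
      mirrored = opposite ∘ Y.colour

      opposite-injective : ∀ {i j : Colour} → opposite i ≡ opposite j → i ≡ j
      opposite-injective {i} {j} eq =
        trans (sym (opposite-involutive i)) (trans (cong opposite eq) (opposite-involutive j))

      c : Fin n → Colour
      c w with X.dom? w
      ... | yes _ = X.colour w
      ... | no _  = mirrored w

      c-X : ∀ {w} → X.Dom w → c w ≡ X.colour w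
      c-X {w} w∈ with X.dom? w
      ... | yes _ = refl
      ... | no w∉ = contradiction w∈ w∉

      c-Y : ∀ {w} → Y.Dom w → c w ≡ mirrored w
      c-Y {w} w∈ with X.dom? w
      ... | yes w∈X = contradiction (inj₁ refl) (apart w∈X w∈)
      ... | no _    = refl

      Dom : Fin n → Set
      Dom w = X.Dom w ⊎ Y.Dom w

      c-proper : ProperOn Dom c
      c-proper (inj₁ a∈) (inj₁ b∈) a~b eq = X.proper a∈ b∈ a~b (trans (sym (c-X a∈)) (trans eq (c-X b∈)))
      c-proper (inj₁ a∈) (inj₂ b∈) a~b _  = apart a∈ b∈ (inj₂ a~b)
      c-proper (inj₂ a∈) (inj₁ b∈) a~b _  = apart b∈ a∈ (inj₂ (adj-sym G a~b))
      c-proper (inj₂ a∈) (inj₂ b∈) a~b eq = Y.proper a∈ b∈ a~b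
        (opposite-injective (trans (sym (c-Y a∈)) (trans eq (c-Y b∈))))

      extension = greedy-extension (λ w → X.dom? w ⊎-dec Y.dom? w) c c-proper
      c′ = proj₁ extension

      c′-proper : ProperColouring G (suc d) c′
      c′-proper = proj₁ (proj₂ extension)

      c′-X : ∀ {w} → X.Dom w → c′ w ≡ X.colour w
      c′-X w∈ = trans (proj₂ (proj₂ extension) (inj₁ w∈)) (c-X w∈)

      c′-Y : ∀ {w} → Y.Dom w → c′ w ≡ mirrored w
      c′-Y w∈ = trans (proj₂ (proj₂ extension) (inj₂ w∈)) (c-Y w∈)

      opposite-small : ∀ i → ¬ toℕ i ≤ ⌊ d /2⌋ → toℕ (opposite i) ≤ ⌊ d /2⌋
      opposite-small i i≰k = subst (_≤ ⌊ d /2⌋) (sym (opposite-prop i)) (m≤n+o⇒m∸n≤o d (toℕ i)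
        (≤-trans (≤-reflexive (trans (sym (⌊n/2⌋+⌈n/2⌉≡n d)) (+-comm ⌊ d /2⌋ ⌈ d /2⌉)))
                 -- At `suc d` the library inequality computes to `⌈ d /2⌉ ≤ suc ⌊ d /2⌋`, so a
                 -- colour above `⌊ d /2⌋` is at least `⌈ d /2⌉`.
                 (+-mono-≤ (≤-trans (⌊n/2⌋≤⌈n/2⌉ (suc d)) (≰⇒> i≰k)) ≤-refl)))

      rainbow-vertex : ∀ i → ∃ λ v → c′ v ≡ i × Rainbow c′ v
      rainbow-vertex i with toℕ i ≤? ⌊ d /2⌋
      ... | yes i≤k with v , cv≡i , rainbow , star⊆ ← X.centre i i≤k =
        v , trans (c′-X (star⊆ (inj₁ refl))) cv≡i , λ a∈ b∈ eq →
          rainbow a∈ b∈ (trans (sym (c′-X (star⊆ a∈))) (trans eq (c′-X (star⊆ b∈))))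
      ... | no i≰k with v , cv≡i , rainbow , star⊆ ← Y.centre (opposite i) (opposite-small i i≰k) =
        v , trans (c′-Y (star⊆ (inj₁ refl))) (trans (cong opposite cv≡i) (opposite-involutive i)) ,
          λ a∈ b∈ eq → rainbow a∈ b∈
            (opposite-injective (trans (sym (c′-Y (star⊆ a∈))) (trans eq (c′-Y (star⊆ b∈)))))

      b-vertex : ∀ i → ∃ λ v → c′ v ≡ i × (∀ j → j ≢ i → ∃ λ w → v ~ w × c′ w ≡ j)
      b-vertex i with v , refl , rainbow ← rainbow-vertex i = v , refl , rainbow⇒b-vertex rainbow

theorem4 : ∀ {n} .{{_ : NonZero n}} (d : ℕ) (G : Graph n) (D : ℕ∞) →
    Regular d G → ¬ Contains G C₄ →
    IsDiameter G D → [ 6 ] ≤∞ D →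
    IsBChromaticNumber G (d + 1)
theorem4 d G D reg no-C₄ diam 6≤D = subst (IsBChromaticNumber G) (+-comm 1 d)
  (b-colouring no-C₄ (proj₂ (proj₂ (distant-pair G diam 6≤D))) , b-colouring-bound)
  where open RegularGraph d G reg
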